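{- Let $n$ be a prime number. Then $n \equiv 1 \pmod 4$ if and only if there exists a unique pair $(u,v)$ of natural numbers such that $u$ is odd, $v$ is even, and $n = u^2 + v^2$.
   Context: Natural numbers are $\mathbb{N} = \{0,1,2,\dots\}$. -}

module Defs where

{-# OPTIONS --safe #-}
-- Existence is Zagier's proof: on the finite set {(x , y , z) : x² + 4yz = n}
-- his involution has exactly one fixed point, so the set has odd size and the
-- involution swapping y and z must have a fixed point x² + (2y)² = n as well.
-- Uniqueness: if n = a² + b² = c² + d² then n divides
-- (ad - bc)(ad + bc) = n(d² - b²), hence one of the factors, and
-- n² = (ac + bd)² + (ad - bc)² = (ac - bd)² + (ad + bc)²
-- bounds both; the parities exclude ac = bd.
module Submission where

open import Defs
open import Data.Nat using (ℕ; _+_; _^_; _%_; zero; suc; _*_; _≤_; _<_; _≟_; z≤n; s≤s; ≢-nonZero⁻¹; >-nonZero)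
open import Data.Nat.Divisibility using (_∣_; _∤_; divides; ∣m+n∣m⇒∣n; ∣m∣n⇒∣m+n; m∣m*n; ∣1⇒≡1; ∣n⇒∣m*n; ∣m⇒∣m*n; ∣⇒≤; m%n≡0⇒n∣m)
open import Data.Nat.DivMod using (_/_; m≡m%n+[m/n]*n; m%n<n; [m+kn]%n≡m%n)
open import Data.Nat.Primality using (Prime; euclidsLemma; prime⇒irreducible; prime⇒nonZero; prime[2]; ¬prime[1])
open import Data.Nat.Properties
open import Data.Nat.Tactic.RingSolver using (solve-∀)
open import Data.Product using (_×_; _,_; ∃!; ∃; ∃₂; proj₂)
open import Data.Sum using (_⊎_; inj₁; inj₂; [_,_]′; reduce)
open import Data.Empty using (⊥; ⊥-elim)
open import Data.List using (List; []; _∷_; _++_; length; filter; cartesianProduct; upTo)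
open import Data.List.Membership.Propositional using (_∈_; find; lose)
open import Data.List.Membership.Propositional.Properties using (∈-∃++; ∈-filter⁺; ∈-filter⁻; ∈-cartesianProduct⁺; ∈-upTo⁺)
open import Data.List.Relation.Unary.Any using (here; there; any?)
open import Data.List.Relation.Unary.All using (_∷_; lookup)
open import Data.List.Relation.Unary.AllPairs using ([]; _∷_)
open import Data.List.Relation.Unary.Unique.Propositional using (Unique)
open import Data.List.Relation.Unary.Unique.Propositional.Properties using (filter⁺; cartesianProduct⁺; upTo⁺)
open import Data.List.Relation.Binary.Permutation.Propositional using (_↭_; ↭-sym; prep; ↭⇒↭ₛ)
open import Data.List.Relation.Binary.Permutation.Propositional.Properties using (shift; ∈-resp-↭; ↭-length)
import Data.List.Relation.Binary.Permutation.Setoid.Properties as Permutationₛ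
open import Function using (_∘_)
open import Function.Bundles using (_⇔_; mk⇔)
open import Relation.Binary.Core using (Rel)
open import Relation.Binary.Definitions using (Symmetric; tri<; tri≈; tri>)
open import Relation.Binary.PropositionalEquality using (_≡_; _≢_; refl; sym; trans; cong; cong₂; subst; subst₂; setoid; module ≡-Reasoning)
open import Relation.Nullary using (¬_; yes; no; contradiction)
open import Level using (0ℓ)

-- Parity of a finite list under an involution.

module _ {A : Set} where

  Unique-resp-↭ : {xs ys : List A} → xs ↭ ys → Unique xs → Unique ys
  Unique-resp-↭ σ = Permutationₛ.Unique-resp-↭ (setoid A) (↭⇒↭ₛ σ)

  ∈⇒↭∷ : ∀ {x : A} {xs} → x ∈ xs → ∃ λ ys → xs ↭ x ∷ ys
  ∈⇒↭∷ x∈xs with ys , zs , refl ← ∈-∃++ x∈xs = ys ++ zs , shift _ ys zs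

  -- For a symmetric functional `R` this makes the partial involution restrict to a genuine
  -- involution of `xs`.
  TotalOn : Rel A 0ℓ → List A → Set
  TotalOn R xs = ∀ {x} → x ∈ xs → ∃ λ y → y ∈ xs × R x y

  Functional : Rel A 0ℓ → Set
  Functional R = ∀ {x y z} → R x y → R x z → y ≡ z

  -- A symmetric functional relation is the graph of a partial involution.
  module Involution {R : Rel A 0ℓ} (R-sym : Symmetric R) (R-fun : Functional R) where

    total-∷⁻ : ∀ {a xs} → R a a → Unique (a ∷ xs) → TotalOn R (a ∷ xs) → TotalOn R xs
    total-∷⁻ Raa (a∉xs ∷ _) total x∈xs with total (there x∈xs)
    ... | _ , here refl , Rxa = contradiction (R-fun Raa (R-sym Rxa)) (lookup a∉xs x∈xs)
    ... | y , there y∈xs , Rxy = y , y∈xs , Rxy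

    -- If a remaining element had `a` or `b` as its partner, functionality would identify it with
    -- the other of the two, against distinctness.
    total-∷∷⁻ : ∀ {a b xs} → R a b → Unique (a ∷ b ∷ xs) → TotalOn R (a ∷ b ∷ xs) → TotalOn R xs
    total-∷∷⁻ Rab ((_ ∷ a∉xs) ∷ b∉xs ∷ _) total x∈xs with total (there (there x∈xs))
    ... | _ , here refl , Rxa = contradiction (R-fun Rab (R-sym Rxa)) (lookup b∉xs x∈xs)
    ... | _ , there (here refl) , Rxb = contradiction (R-fun (R-sym Rab) (R-sym Rxb)) (lookup a∉xs x∈xs)
    ... | y , there (there y∈xs) , Rxy = y , y∈xs , Rxy

    total-resp-↭ : ∀ {xs ys} → xs ↭ ys → TotalOn R xs → TotalOn R ys
    total-resp-↭ σ total y∈ys with z , z∈xs , Ryz ← total (∈-resp-↭ (↭-sym σ) y∈ys) =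
      z , ∈-resp-↭ σ z∈xs , Ryz

    -- The head and its partner are distinct; strip both and induct.
    fixedPointFree⇒even : ∀ {xs} → Unique xs → TotalOn R xs →
                          (∀ {x} → x ∈ xs → ¬ R x x) → 2 ∣ length xs
    fixedPointFree⇒even {xs} = go (length xs) xs ≤-refl
      where
      -- The bound `k` drives the recursion, since the list left after extracting the partner is not
      -- a subterm of the original.
      go : ∀ k xs → length xs ≤ k → Unique xs → TotalOn R xs →
           (∀ {x} → x ∈ xs → ¬ R x x) → 2 ∣ length xs
      go _ [] _ _ _ _ = divides 0 refl
      go (suc k) (x ∷ xs) (s≤s len≤k) unique total free with total (here refl)
      ... | _ , here refl , Rxx = contradiction Rxx (free (here refl))
      ... | y , there y∈xs , Rxy with ys , σ ← ∈⇒↭∷ y∈xs =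
        subst (λ l → 2 ∣ suc l) (sym (↭-length σ)) (∣m∣n⇒∣m+n (m∣m*n 1) even-ys)
        where
        unique′ : Unique (x ∷ y ∷ ys)
        unique′ = Unique-resp-↭ (prep x σ) unique

        unique-ys : Unique ys
        unique-ys with _ ∷ _ ∷ u ← unique′ = u

        even-ys : 2 ∣ length ys
        even-ys = go k ys
          (≤-trans (n≤1+n _) (subst (_≤ k) (↭-length σ) len≤k))
          unique-ys
          (total-∷∷⁻ Rxy unique′ (total-resp-↭ (prep x σ) total))
          (free ∘ there ∘ ∈-resp-↭ (↭-sym σ) ∘ there)

    -- Without `a` no fixed point is left, so the remaining elements are even in number.
    uniqueFixedPoint⇒odd : ∀ {a xs} → Unique xs → TotalOn R xs → a ∈ xs → R a a →
                           (∀ {x} → x ∈ xs → R x x → x ≡ a) → 2 ∤ length xs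
    uniqueFixedPoint⇒odd {a} unique total a∈xs Raa only-a even with ys , σ ← ∈⇒↭∷ a∈xs
      with unique′@(a∉ys ∷ unique-ys) ← Unique-resp-↭ σ unique =
      contradiction (∣1⇒≡1 (∣m+n∣m⇒∣n even′ even-ys)) λ ()
      where
      even-ys : 2 ∣ length ys
      even-ys = fixedPointFree⇒even unique-ys (total-∷⁻ Raa unique′ (total-resp-↭ σ total))
        λ y∈ys Ryy → lookup a∉ys y∈ys (sym (only-a (∈-resp-↭ (↭-sym σ) (there y∈ys)) Ryy))

      even′ : 2 ∣ length ys + 1
      even′ = subst (2 ∣_) (trans (↭-length σ) (+-comm 1 (length ys))) even

-- Zagier's involution

Triple : Set
Triple = ℕ × ℕ × ℕ

norm : Triple → ℕ
norm (x , y , z) = x * x + 4 * (y * z)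

-- Zagier's three cases x < y - z, y - z < x < 2y and x > 2y, as a relation
-- with every subtraction turned into an addition; the third case is the
-- inverse of the first.
data _~_ : Rel Triple 0ℓ where
  forth : ∀ {x x′ y z w} → x′ ≡ x + 2 * z → y ≡ x + z + w → 0 < x → 0 < w →
          (x , y , z) ~ (x′ , z , w)
  back  : ∀ {x x′ y z w} → x′ ≡ x + 2 * z → y ≡ x + z + w → 0 < x → 0 < w →
          (x′ , z , w) ~ (x , y , z)
  swing : ∀ {x x′ y z z′} → x + x′ ≡ 2 * y → x + z ≡ y + z′ →
          0 < x → 0 < x′ → 0 < z → 0 < z′ → (x , y , z) ~ (x′ , y , z′)

~-sym : Symmetric _~_
~-sym (forth p q 0<x 0<w) = back p q 0<x 0<w
~-sym (back p q 0<x 0<w) = forth p q 0<x 0<w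
~-sym {x , y , z} (swing {x′ = x′} {z′ = z′} p q 0<x 0<x′ 0<z 0<z′) =
  swing (trans (+-comm x′ x) p) (+-cancelˡ-≡ x _ _ eq) 0<x′ 0<x 0<z′ 0<z
  where
  open ≡-Reasoning
  split : ∀ y z′ → 2 * y + z′ ≡ y + (y + z′)
  split = solve-∀
  swap-mid : ∀ x y z → y + (x + z) ≡ x + (y + z)
  swap-mid = solve-∀
  -- The extra `x` on both sides completes `x + x′`, which `p` turns into `2 * y`.
  eq : x + (x′ + z′) ≡ x + (y + z)
  eq = begin
    x + (x′ + z′)  ≡⟨ +-assoc x x′ z′ ⟨
    x + x′ + z′    ≡⟨ cong (_+ z′) p ⟩
    2 * y + z′     ≡⟨ split y z′ ⟩
    y + (y + z′)   ≡⟨ cong (y +_) q ⟨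
    y + (x + z)    ≡⟨ swap-mid x y z ⟩
    x + (y + z)    ∎

m≢m+[d+e] : ∀ {m d e} → 0 < d → m ≢ m + (d + e)
m≢m+[d+e] {m} {d} {e} 0<d eq = <-irrefl eq (m<m+n m (<-≤-trans 0<d (m≤m+n d e)))

-- This and the next two lemmas separate the cases by their sources: `forth` has y > x + z, `back`
-- has x > 2y, `swing` has x < 2y and y < x + z.
forth-back-disjoint : ∀ x₀ {x} y z w → x ≡ x₀ + 2 * y → y ≡ x + z + w → 0 < w → ⊥
forth-back-disjoint x₀ y z w refl q 0<w =
  m≢m+[d+e] {e = x₀ + y + z} 0<w (trans q (arrange x₀ y z w))
  where
  arrange : ∀ x₀ y z w → x₀ + 2 * y + z + w ≡ y + (w + (x₀ + y + z))
  arrange = solve-∀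

forth-swing-disjoint : ∀ x {y} z w z′ → y ≡ x + z + w → x + z ≡ y + z′ → 0 < w → ⊥
forth-swing-disjoint x z w z′ refl q 0<w =
  m≢m+[d+e] 0<w (trans q (+-assoc (x + z) w z′))

back-swing-disjoint : ∀ x₀ {x} x′ y → x ≡ x₀ + 2 * y → x + x′ ≡ 2 * y → 0 < x₀ → ⊥
back-swing-disjoint x₀ x′ y refl q 0<x₀ =
  m≢m+[d+e] 0<x₀ (trans (sym q) (arrange x₀ x′ y))
  where
  arrange : ∀ x₀ x′ y → x₀ + 2 * y + x′ ≡ 2 * y + (x₀ + x′)
  arrange = solve-∀

-- Disjointness leaves only pairs of equal cases, where cancellation recovers the entry of the
-- target that the source does not show directly.
~-functional : Functional _~_
~-functional (forth {x} {z = z} refl q _ _) (forth refl q′ _ _) =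
  cong (λ w → _ , _ , w) (+-cancelˡ-≡ (x + z) _ _ (trans (sym q) q′))
~-functional (forth {y = y} {z} {w} _ q _ 0<w) (back {x₀} p _ _ _) =
  ⊥-elim (forth-back-disjoint x₀ y z w p q 0<w)
~-functional (forth {x} {z = z} {w} _ q _ 0<w) (swing {z′ = z′} _ q′ _ _ _ _) =
  ⊥-elim (forth-swing-disjoint x z w z′ q q′ 0<w)
~-functional (back {x₀} p _ _ _) (forth {y = y} {z} {w} _ q _ 0<w) =
  ⊥-elim (forth-back-disjoint x₀ y z w p q 0<w)
~-functional (back {z = z} {w} p refl _ _) (back p′ refl _ _) =
  cong (λ x → x , x + z + w , z) (+-cancelʳ-≡ (2 * z) _ _ (trans (sym p) p′))
~-functional (back {x₀} p _ 0<x₀ _) (swing {x′ = x′} {y} p′ _ _ _ _ _) =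
  ⊥-elim (back-swing-disjoint x₀ x′ y p p′ 0<x₀)
~-functional (swing {z′ = z′} _ q′ _ _ _ _) (forth {x} {z = z} {w} _ q _ 0<w) =
  ⊥-elim (forth-swing-disjoint x z w z′ q q′ 0<w)
~-functional (swing {x′ = x′} {y} p′ _ _ _ _ _) (back {x₀} p _ 0<x₀ _) =
  ⊥-elim (back-swing-disjoint x₀ x′ y p p′ 0<x₀)
~-functional (swing {x} {y = y} p q _ _ _ _) (swing p′ q′ _ _ _ _) =
  cong₂ (λ x z → x , _ , z)
    (+-cancelˡ-≡ x _ _ (trans p (sym p′)))
    (+-cancelˡ-≡ y _ _ (trans (sym q) q′))

norm-forth : ∀ x z w → norm (x , x + z + w , z) ≡ norm (x + 2 * z , z , w)
norm-forth = expand
  where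
  expand : ∀ x z w → x * x + 4 * ((x + z + w) * z) ≡ (x + 2 * z) * (x + 2 * z) + 4 * (z * w)
  expand = solve-∀

~-norm : ∀ {s t} → s ~ t → norm s ≡ norm t
~-norm (forth {x} {z = z} {w} refl refl _ _) = norm-forth x z w
~-norm (back {x} {z = z} {w} refl refl _ _) = sym (norm-forth x z w)
-- Here x′ = 2y - x and z′ = x - y + z. Adding 4y² = (2y)² to both sides allows `2 * y` to be traded
-- for `x + x′` and back without subtraction.
~-norm {x , y , z} (swing {x′ = x′} {z′ = z′} p q _ _ _ _) = +-cancelʳ-≡ (4 * (y * y)) _ _ (begin
  x * x + 4 * (y * z) + 4 * (y * y)            ≡⟨ complete-square x y z ⟩
  x * x + 4 * (y * z) + 2 * y * (2 * y)        ≡⟨ cong (λ s → x * x + 4 * (y * z) + s * s) p ⟨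
  x * x + 4 * (y * z) + (x + x′) * (x + x′)    ≡⟨ regroup x x′ y z ⟩
  x′ * x′ + 4 * (y * z) + (x + x′) * (2 * x)   ≡⟨ cong (λ s → x′ * x′ + 4 * (y * z) + s * (2 * x)) p ⟩
  x′ * x′ + 4 * (y * z) + 2 * y * (2 * x)      ≡⟨ factor x x′ y z ⟩
  x′ * x′ + 4 * (y * (x + z))                  ≡⟨ cong (λ s → x′ * x′ + 4 * (y * s)) q ⟩
  x′ * x′ + 4 * (y * (y + z′))                 ≡⟨ expand x′ y z′ ⟩
  x′ * x′ + 4 * (y * z′) + 4 * (y * y)         ∎)
  where
  open ≡-Reasoning
  complete-square : ∀ x y z → x * x + 4 * (y * z) + 4 * (y * y) ≡ x * x + 4 * (y * z) + 2 * y * (2 * y)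
  complete-square = solve-∀
  regroup : ∀ x x′ y z → x * x + 4 * (y * z) + (x + x′) * (x + x′) ≡ x′ * x′ + 4 * (y * z) + (x + x′) * (2 * x)
  regroup = solve-∀
  factor : ∀ x x′ y z → x′ * x′ + 4 * (y * z) + 2 * y * (2 * x) ≡ x′ * x′ + 4 * (y * (x + z))
  factor = solve-∀
  expand : ∀ x′ y z′ → x′ * x′ + 4 * (y * (y + z′)) ≡ x′ * x′ + 4 * (y * z′) + 4 * (y * y)
  expand = solve-∀

-- A triple fixed by `forth` or `back` would satisfy x = x + 2z with z positive; `swing` gives 2x =
-- 2y.
~-fixed : ∀ {x y z} → (x , y , z) ~ (x , y , z) → x ≡ y
~-fixed (forth p _ _ 0<w) = contradiction p (m≢m+[d+e] 0<w)
~-fixed (back p _ _ 0<w) = contradiction p (m≢m+[d+e] 0<w)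
~-fixed {x} {y} (swing p _ _ _ _ _) = *-cancelˡ-≡ x y 2 (trans (cong (x +_) (+-identityʳ x)) p)

_⇄_ : Rel Triple 0ℓ
(x , y , z) ⇄ (x′ , y′ , z′) = x ≡ x′ × y ≡ z′ × z ≡ y′

⇄-sym : Symmetric _⇄_
⇄-sym (refl , refl , refl) = refl , refl , refl

⇄-functional : Functional _⇄_
⇄-functional (refl , refl , refl) (refl , refl , refl) = refl

⇄-norm : ∀ {s t} → s ⇄ t → norm s ≡ norm t
⇄-norm {x , y , z} (refl , refl , refl) = cong (λ m → x * x + 4 * m) (*-comm y z)

-- Parity and primes

odd⇒1+2* : ∀ {u} → 2 ∤ u → ∃ λ i → u ≡ 1 + i * 2
odd⇒1+2* {u} 2∤u with u % 2 in eq | m≡m%n+[m/n]*n u 2 | m%n<n u 2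
... | 0 | _ | _ = contradiction (m%n≡0⇒n∣m u 2 eq) 2∤u
... | 1 | u≡ | _ = u / 2 , u≡
... | suc (suc _) | _ | s≤s (s≤s ())

-- With u = 1 + 2i and v = 2j the sum is 1 + 4(i² + i + j²). This settles the converse direction of
-- the equivalence.
odd²+even²%4≡1 : ∀ {u v} → 2 ∤ u → 2 ∣ v → (u * u + v * v) % 4 ≡ 1
odd²+even²%4≡1 2∤u (divides j refl) with i , refl ← odd⇒1+2* 2∤u =
  trans (cong (_% 4) (expand i j)) ([m+kn]%n≡m%n 1 (i * i + i + j * j) 4)
  where
  expand : ∀ i j → (1 + i * 2) * (1 + i * 2) + (j * 2) * (j * 2) ≡ 1 + (i * i + i + j * j) * 4
  expand = solve-∀

odd*odd : ∀ {a b} → 2 ∤ a → 2 ∤ b → 2 ∤ a * b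
odd*odd {a} {b} 2∤a 2∤b = [ 2∤a , 2∤b ]′ ∘ euclidsLemma a b prime[2]

odd⇒>0 : ∀ {a} → 2 ∤ a → 0 < a
odd⇒>0 {zero} 2∤0 = contradiction (divides 0 refl) 2∤0
odd⇒>0 {suc _} _ = s≤s z≤n

prime[m*n]⇒m≡1⊎n≡1 : ∀ {m n} → Prime (m * n) → m ≡ 1 ⊎ n ≡ 1
prime[m*n]⇒m≡1⊎n≡1 {zero} pr = contradiction refl (≢-nonZero⁻¹ 0 {{prime⇒nonZero pr}})
prime[m*n]⇒m≡1⊎n≡1 {m@(suc _)} {n} pr with prime⇒irreducible pr (m∣m*n {m} n)
... | inj₁ m≡1 = inj₁ m≡1
... | inj₂ m≡m*n = inj₂ (*-cancelˡ-≡ n 1 m (trans (sym m≡m*n) (sym (*-identityʳ m))))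

¬prime[m*m] : ∀ {m} → ¬ Prime (m * m)
¬prime[m*m] {m} pr with refl ← reduce (prime[m*n]⇒m≡1⊎n≡1 {m} pr) = ¬prime[1] pr

m<n⇒∃[o]m+o≡n : ∀ {m n} → m < n → ∃ λ o → m + o ≡ n × 0 < o
m<n⇒∃[o]m+o≡n {m} m<n with o , refl ← m≤n⇒∃[o]m+o≡n m<n = suc o , +-suc m o , s≤s z≤n

-- Existence

module _ {p} (pr : Prime p) (p%4≡1 : p % 4 ≡ 1) where

  p≡1+[p/4]*4 : p ≡ 1 + p / 4 * 4
  p≡1+[p/4]*4 = trans (m≡m%n+[m/n]*n p 4) (cong (_+ p / 4 * 4) p%4≡1)

  2∤p : 2 ∤ p
  2∤p 2∣p = contradiction (∣1⇒≡1 (∣m+n∣m⇒∣n 2∣[p/4]*4+1 (∣n⇒∣m*n (p / 4) (divides 2 refl)))) λ ()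
    where
    2∣[p/4]*4+1 : 2 ∣ p / 4 * 4 + 1
    2∣[p/4]*4+1 = subst (2 ∣_) (trans p≡1+[p/4]*4 (+-comm 1 _)) 2∣p

  4*m≢p : ∀ m → 4 * m ≢ p
  4*m≢p m eq = 2∤p (subst (2 ∣_) eq (∣m⇒∣m*n m (divides 2 refl)))

  m*m≢p : ∀ m → m * m ≢ p
  m*m≢p m refl = ¬prime[m*m] {m} pr

  -- This and the next three lemmas exclude the boundary triples, each of which would make `p` a
  -- multiple of 4 or a perfect square. Zagier's strict inequalities therefore cover every triple.
  norm≡p⇒0<x : ∀ x y z → norm (x , y , z) ≡ p → 0 < x
  norm≡p⇒0<x zero y z eq = contradiction eq (4*m≢p (y * z))
  norm≡p⇒0<x (suc _) _ _ _ = s≤s z≤n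

  norm≡p⇒0<z : ∀ x y z → norm (x , y , z) ≡ p → 0 < z
  norm≡p⇒0<z x y zero eq = contradiction (trans (expand x y) eq) (m*m≢p x)
    where
    expand : ∀ x y → x * x ≡ x * x + 4 * (y * 0)
    expand = solve-∀
  norm≡p⇒0<z _ _ (suc _) _ = s≤s z≤n

  norm≡p⇒x+z≢y : ∀ x y z → norm (x , y , z) ≡ p → x + z ≢ y
  norm≡p⇒x+z≢y x _ z eq refl = m*m≢p (x + 2 * z) (trans (square x z) eq)
    where
    square : ∀ x z → (x + 2 * z) * (x + 2 * z) ≡ x * x + 4 * ((x + z) * z)
    square = solve-∀

  norm≡p⇒x≢2*y : ∀ x y z → norm (x , y , z) ≡ p → x ≢ 2 * y
  norm≡p⇒x≢2*y _ y z eq refl = 4*m≢p (y * y + y * z) (trans (factor y z) eq)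
    where
    factor : ∀ y z → 4 * (y * y + y * z) ≡ 2 * y * (2 * y) + 4 * (y * z)
    factor = solve-∀

  ~-total : ∀ t → norm t ≡ p → ∃ (t ~_)
  ~-total (x , y , z) eq with <-cmp (x + z) y | <-cmp x (2 * y)
  ... | tri≈ _ x+z≡y _ | _ = contradiction x+z≡y (norm≡p⇒x+z≢y x y z eq)
  ... | _ | tri≈ _ x≡2y _ = contradiction x≡2y (norm≡p⇒x≢2*y x y z eq)
  ... | tri< x+z<y _ _ | _ with w , refl , 0<w ← m<n⇒∃[o]m+o≡n x+z<y =
    _ , forth refl refl (norm≡p⇒0<x x y z eq) 0<w
  ... | tri> _ _ _ | tri> _ _ 2y<x with w , refl , 0<w ← m<n⇒∃[o]m+o≡n 2y<x =
    -- The difference x - 2y becomes the first entry of the new triple, and `z` takes the place of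
    -- the `w` of `back`.
    _ , back (+-comm (2 * y) w) refl 0<w (norm≡p⇒0<z x y z eq)
  ... | tri> _ _ y<x+z | tri< x<2y _ _
    with x′ , p , 0<x′ ← m<n⇒∃[o]m+o≡n x<2y | z′ , q , 0<z′ ← m<n⇒∃[o]m+o≡n y<x+z =
    _ , swing p (sym q) (norm≡p⇒0<x x y z eq) 0<x′ (norm≡p⇒0<z x y z eq) 0<z′

  -- Bounds on the three entries confine the triples to a finite box. Positivity yields x ≤ x² and y
  -- ≤ yz; the swap carries the bound on `y` over to `z`.
  norm≡p⇒x≤p : ∀ x y z → norm (x , y , z) ≡ p → x ≤ p
  norm≡p⇒x≤p x y z eq = subst (x ≤_) eq
    (≤-trans (m≤m*n x x {{>-nonZero (norm≡p⇒0<x x y z eq)}}) (m≤m+n (x * x) _))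

  norm≡p⇒y≤p : ∀ x y z → norm (x , y , z) ≡ p → y ≤ p
  norm≡p⇒y≤p x y z eq = subst (y ≤_) eq
    (≤-trans (m≤m*n y z {{>-nonZero (norm≡p⇒0<z x y z eq)}})
      (≤-trans (m≤n*m (y * z) 4) (m≤n+m _ (x * x))))

  norm≡p⇒z≤p : ∀ x y z → norm (x , y , z) ≡ p → z ≤ p
  norm≡p⇒z≤p x y z eq =
    norm≡p⇒y≤p x z y (trans (⇄-norm {x , z , y} (refl , refl , refl)) eq)

  box : List Triple
  box = cartesianProduct (upTo (suc p)) (cartesianProduct (upTo (suc p)) (upTo (suc p)))

  solutions : List Triple
  solutions = filter (λ t → norm t ≟ p) box

  solutions-unique : Unique solutions
  solutions-unique = filter⁺ (λ t → norm t ≟ p) {box}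
    (cartesianProduct⁺ (upTo⁺ (suc p)) (cartesianProduct⁺ (upTo⁺ (suc p)) (upTo⁺ (suc p))))

  ∈-solutions⁺ : ∀ {t} → norm t ≡ p → t ∈ solutions
  ∈-solutions⁺ {x , y , z} eq = ∈-filter⁺ (λ t → norm t ≟ p)
    (∈-cartesianProduct⁺ (∈-upTo⁺ (s≤s (norm≡p⇒x≤p x y z eq)))
      (∈-cartesianProduct⁺ (∈-upTo⁺ (s≤s (norm≡p⇒y≤p x y z eq)))
        (∈-upTo⁺ (s≤s (norm≡p⇒z≤p x y z eq))))) eq

  ∈-solutions⁻ : ∀ {t} → t ∈ solutions → norm t ≡ p
  ∈-solutions⁻ t∈ = proj₂ (∈-filter⁻ (λ t → norm t ≟ p) {xs = box} t∈)

  -- Serves both involutions: preserving `norm` keeps partners inside `solutions`.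
  total-solutions : ∀ {R : Rel Triple 0ℓ} → (∀ {s t} → R s t → norm s ≡ norm t) →
                    (∀ t → norm t ≡ p → ∃ (R t)) → TotalOn R solutions
  total-solutions R-norm R-total {s} s∈ with t , Rst ← R-total s (∈-solutions⁻ s∈) =
    t , ∈-solutions⁺ (trans (sym (R-norm Rst)) (∈-solutions⁻ s∈)) , Rst

  norm[1,1,p/4]≡p : norm (1 , 1 , p / 4) ≡ p
  norm[1,1,p/4]≡p = trans (arrange (p / 4)) (sym p≡1+[p/4]*4)
    where
    arrange : ∀ k → 1 + 4 * (1 * k) ≡ 1 + k * 4
    arrange = solve-∀

  ~-fixed[1,1,p/4] : (1 , 1 , p / 4) ~ (1 , 1 , p / 4)
  ~-fixed[1,1,p/4] = swing refl refl (s≤s z≤n) (s≤s z≤n) 0<p/4 0<p/4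
    where
    0<p/4 : 0 < p / 4
    -- A zero quotient would make `p` the square 1.
    0<p/4 = norm≡p⇒0<z 1 1 (p / 4) norm[1,1,p/4]≡p

  -- The norm factors as x(x + 4z), so one factor is 1; if it is the second, then 0 < x ≤ 1.
  norm[x,x,z]≡p⇒x≡1 : ∀ {x z} → norm (x , x , z) ≡ p → x ≡ 1
  norm[x,x,z]≡p⇒x≡1 {x} {z} eq
    with prime[m*n]⇒m≡1⊎n≡1 {x} {x + 4 * z} (subst Prime (sym (trans (factor x z) eq)) pr)
    where
    factor : ∀ x z → x * (x + 4 * z) ≡ x * x + 4 * (x * z)
    factor = solve-∀
  ... | inj₁ x≡1 = x≡1
  ... | inj₂ x+4z≡1 = ≤-antisym (subst (x ≤_) x+4z≡1 (m≤m+n x _)) (norm≡p⇒0<x x x z eq)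

  ~-fixed-unique : ∀ {t} → t ∈ solutions → t ~ t → t ≡ (1 , 1 , p / 4)
  ~-fixed-unique {x , y , z} t∈ t~t with refl ← ~-fixed t~t
    with refl ← norm[x,x,z]≡p⇒x≡1 {x} {z} (∈-solutions⁻ t∈) =
    cong (λ z → 1 , 1 , z) (trans (sym (+-identityʳ z)) (*-cancelˡ-≡ _ _ 4
      (trans (suc-injective (trans (∈-solutions⁻ t∈) p≡1+[p/4]*4)) (*-comm (p / 4) 4))))

  odd-solutions : 2 ∤ length solutions
  odd-solutions = Involution.uniqueFixedPoint⇒odd ~-sym ~-functional solutions-unique
    (total-solutions ~-norm ~-total) (∈-solutions⁺ norm[1,1,p/4]≡p) ~-fixed[1,1,p/4] ~-fixed-unique

  sumOfTwoSquares : ∃₂ λ u v → 2 ∤ u × 2 ∣ v × p ≡ u * u + v * v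
  -- Searching the finite list for y = z stands in for excluded middle: failure means that the swap
  -- has no fixed point, which contradicts `odd-solutions`.
  sumOfTwoSquares with any? (λ (x , y , z) → y ≟ z) solutions
  ... | no none = contradiction
    (Involution.fixedPointFree⇒even ⇄-sym ⇄-functional solutions-unique
      (total-solutions ⇄-norm λ (x , y , z) _ → (x , z , y) , refl , refl , refl)
      λ t∈ (_ , y≡z , _) → none (lose t∈ y≡z))
    odd-solutions
  ... | yes some with (x , y , .y) , t∈ , refl ← find some =
    x , 2 * y , 2∤x , m∣m*n y , trans (sym (∈-solutions⁻ t∈)) (square x y)
    where
    square : ∀ x y → x * x + 4 * (y * y) ≡ x * x + 2 * y * (2 * y)
    square = solve-∀
    2∤x : 2 ∤ x
    2∤x 2∣x = 2∤p (subst (2 ∣_) (∈-solutions⁻ t∈)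
      (∣m∣n⇒∣m+n (∣m⇒∣m*n x 2∣x) (∣m⇒∣m*n (y * y) (divides 2 refl))))

-- Uniqueness

-- Subtraction-free form of (n - m)² ≤ 0: with n = m + k the left side exceeds 2mn by k².
m≤n⇒m*m+n*n≤2*m*n⇒m≡n : ∀ {m n} → m ≤ n → m * m + n * n ≤ 2 * (m * n) → m ≡ n
m≤n⇒m*m+n*n≤2*m*n⇒m≡n {m} m≤n le with k , refl ← m≤n⇒∃[o]m+o≡n m≤n =
  sym (trans (cong (m +_) k≡0) (+-identityʳ m))
  where
  expand : ∀ m k → m * m + (m + k) * (m + k) ≡ 2 * (m * (m + k)) + k * k
  expand = solve-∀
  k*k≤0 : k * k ≤ 0
  k*k≤0 = +-cancelˡ-≤ (2 * (m * (m + k))) _ _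
    (subst₂ _≤_ (expand m k) (sym (+-identityʳ _)) le)
  k≡0 : k ≡ 0
  k≡0 = reduce (m*n≡0⇒m≡0∨n≡0 k (n≤0⇒n≡0 k*k≤0))

m*m+n*n≤2*m*n⇒m≡n : ∀ {m n} → m * m + n * n ≤ 2 * (m * n) → m ≡ n
m*m+n*n≤2*m*n⇒m≡n {m} {n} le with ≤-total m n
... | inj₁ m≤n = m≤n⇒m*m+n*n≤2*m*n⇒m≡n m≤n le
... | inj₂ n≤m = sym (m≤n⇒m*m+n*n≤2*m*n⇒m≡n n≤m
  (subst₂ _≤_ (+-comm (m * m) (n * n)) (cong (2 *_) (*-comm m n)) le))

∣⇒≡0⊎≤ : ∀ {m n} → m ∣ n → n ≡ 0 ⊎ m ≤ n
∣⇒≡0⊎≤ {n = zero} _ = inj₁ refl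
∣⇒≡0⊎≤ {n = suc _} m∣n = inj₂ (∣⇒≤ m∣n)

m*m≡n*n⇒m≡n : ∀ {m n} → m * m ≡ n * n → m ≡ n
m*m≡n*n⇒m≡n {m} {n} eq with <-cmp m n
... | tri< m<n _ _ = contradiction (*-mono-< m<n m<n) (<-irrefl eq)
... | tri≈ _ m≡n _ = m≡n
... | tri> _ _ n<m = contradiction (*-mono-< n<m n<m) (<-irrefl (sym eq))

-- Here a = c + f and d = b + e, so that c * e + f * b + f * e is ad - bc.
module _ {p} (pr : Prime p) (b c e f : ℕ)
  (2∤a : 2 ∤ c + f) (2∣b : 2 ∣ b) (2∤c : 2 ∤ c)
  (p≡a²+b² : p ≡ (c + f) * (c + f) + b * b) (p≡c²+d² : p ≡ c * c + (b + e) * (b + e)) where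

  private
    a d ad-bc ad+bc : ℕ
    a = c + f
    d = b + e
    ad-bc = c * e + f * b + f * e
    ad+bc = a * d + b * c

  p*p≡[a²+b²][c²+d²] : p * p ≡ (a * a + b * b) * (c * c + d * d)
  p*p≡[a²+b²][c²+d²] = cong₂ _*_ p≡a²+b² p≡c²+d²

  -- Reading `p` as a² + b² on the left and as c² + d² on the right, the difference of the multiples
  -- of `p` is a²d² - b²c².
  pd²≡pb²+[ad-bc][ad+bc] : p * (d * d) ≡ p * (b * b) + ad-bc * ad+bc
  pd²≡pb²+[ad-bc][ad+bc] = trans (cong (_* (d * d)) p≡a²+b²) (trans (expand b c e f)
    (cong (λ n → n * (b * b) + ad-bc * ad+bc) (sym p≡c²+d²)))
    where
    expand : ∀ b c e f →
      ((c + f) * (c + f) + b * b) * ((b + e) * (b + e)) ≡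
      (c * c + (b + e) * (b + e)) * (b * b) +
        (c * e + f * b + f * e) * ((c + f) * (b + e) + b * c)
    expand = solve-∀

  p∣[ad-bc][ad+bc] : p ∣ ad-bc * ad+bc
  p∣[ad-bc][ad+bc] = ∣m+n∣m⇒∣n
    (subst (p ∣_) pd²≡pb²+[ad-bc][ad+bc] (m∣m*n (d * d))) (m∣m*n (b * b))

  0<a : 0 < a
  0<a = odd⇒>0 2∤a

  0<c : 0 < c
  0<c = odd⇒>0 2∤c

  -- If ad - bc = 0, its summand `c * e` vanishes while c > 0. Otherwise p ≤ ad - bc, and p² = (ad -
  -- bc)² + (ac + bd)² with ac + bd > 0 exceeds p².
  p∣ad-bc⇒e≡0 : p ∣ ad-bc → e ≡ 0
  p∣ad-bc⇒e≡0 p∣ad-bc with ∣⇒≡0⊎≤ p∣ad-bc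
  ... | inj₁ ad-bc≡0 = [ (λ c≡0 → contradiction (sym c≡0) (<⇒≢ 0<c)) , (λ e≡0 → e≡0) ]′
    (m*n≡0⇒m≡0∨n≡0 c (m+n≡0⇒m≡0 (c * e) (m+n≡0⇒m≡0 (c * e + f * b) ad-bc≡0)))
  ... | inj₂ p≤ad-bc = contradiction p*p<p*p (<-irrefl refl)
    where
    ac+bd : ℕ
    ac+bd = a * c + b * d

    0<ac+bd : 0 < ac+bd
    0<ac+bd = <-≤-trans (*-mono-< 0<a 0<c) (m≤m+n (a * c) (b * d))

    brahmagupta : ∀ b c e f →
      ((c + f) * (c + f) + b * b) * (c * c + (b + e) * (b + e)) ≡
      (c * e + f * b + f * e) * (c * e + f * b + f * e) +
        ((c + f) * c + b * (b + e)) * ((c + f) * c + b * (b + e))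
    brahmagupta = solve-∀

    open ≤-Reasoning
    p*p<p*p : p * p < p * p
    p*p<p*p = begin-strict
      p * p                               ≤⟨ *-mono-≤ p≤ad-bc p≤ad-bc ⟩
      ad-bc * ad-bc                       <⟨ m<m+n _ (*-mono-< 0<ac+bd 0<ac+bd) ⟩
      ad-bc * ad-bc + ac+bd * ac+bd       ≡⟨ brahmagupta b c e f ⟨
      (a * a + b * b) * (c * c + d * d)   ≡⟨ p*p≡[a²+b²][c²+d²] ⟨
      p * p                               ∎

  -- If ad + bc = 0, then d = b + e vanishes because a > 0. Otherwise p ≤ ad + bc leaves no room for
  -- (ac - bd)² in p², so ac = bd, an odd number equal to an even one.
  p∣ad+bc⇒e≡0 : p ∣ ad+bc → e ≡ 0
  p∣ad+bc⇒e≡0 p∣ad+bc with ∣⇒≡0⊎≤ p∣ad+bc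
  ... | inj₁ ad+bc≡0 = [ (λ a≡0 → contradiction (sym a≡0) (<⇒≢ 0<a)) , m+n≡0⇒n≡0 b ]′
    (m*n≡0⇒m≡0∨n≡0 a (m+n≡0⇒m≡0 (a * d) ad+bc≡0))
  ... | inj₂ p≤ad+bc = contradiction
    (subst (2 ∣_) (sym (m*m+n*n≤2*m*n⇒m≡n [ac]²+[bd]²≤2[ac][bd])) (∣m⇒∣m*n d 2∣b)) (odd*odd 2∤a 2∤c)
    where
    -- The cross term of (ac - bd)² is moved to the other side to stay within the natural numbers.
    brahmagupta : ∀ a b c d →
      (a * a + b * b) * (c * c + d * d) + 2 * (a * c * (b * d)) ≡
      (a * d + b * c) * (a * d + b * c) + (a * c * (a * c) + b * d * (b * d))
    brahmagupta = solve-∀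

    open ≤-Reasoning
    [ac]²+[bd]²≤2[ac][bd] : a * c * (a * c) + b * d * (b * d) ≤ 2 * (a * c * (b * d))
    [ac]²+[bd]²≤2[ac][bd] = +-cancelˡ-≤ (ad+bc * ad+bc) _ _ (begin
      ad+bc * ad+bc + (a * c * (a * c) + b * d * (b * d))         ≡⟨ brahmagupta a b c d ⟨
      (a * a + b * b) * (c * c + d * d) + 2 * (a * c * (b * d))   ≡⟨ cong (_+ 2 * (a * c * (b * d))) p*p≡[a²+b²][c²+d²] ⟨
      p * p + 2 * (a * c * (b * d))                               ≤⟨ +-monoˡ-≤ _ (*-mono-≤ p≤ad+bc p≤ad+bc) ⟩
      ad+bc * ad+bc + 2 * (a * c * (b * d))                       ∎)

  e≡0 : e ≡ 0
  e≡0 = [ p∣ad-bc⇒e≡0 , p∣ad+bc⇒e≡0 ]′ (euclidsLemma ad-bc ad+bc pr p∣[ad-bc][ad+bc])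

module _ {p} (pr : Prime p) where

  -- Together with b ≤ d, a < c would make the first sum of squares strictly smaller than the
  -- second. Hence c ≤ a, and the differences f = a - c and e = d - b exist as naturals.
  b≤d⇒b≡d : ∀ {a b c d} → 2 ∤ a → 2 ∣ b → 2 ∤ c → b ≤ d →
            p ≡ a * a + b * b → p ≡ c * c + d * d → b ≡ d
  b≤d⇒b≡d {a} {b} {c} 2∤a 2∣b 2∤c b≤d p≡a²+b² p≡c²+d² with a <? c
  ... | yes a<c = contradiction
    (+-mono-<-≤ (*-mono-< a<c a<c) (*-mono-≤ b≤d b≤d))
    (<-irrefl (trans (sym p≡a²+b²) p≡c²+d²))
  ... | no a≮c with f , refl ← m≤n⇒∃[o]m+o≡n (≮⇒≥ a≮c) | e , refl ← m≤n⇒∃[o]m+o≡n b≤d =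
    sym (trans (cong (b +_) (e≡0 pr b c e f 2∤a 2∣b 2∤c p≡a²+b² p≡c²+d²)) (+-identityʳ b))

  sumOfTwoSquares-unique : ∀ {a b c d} → 2 ∤ a → 2 ∣ b → 2 ∤ c → 2 ∣ d →
    p ≡ a * a + b * b → p ≡ c * c + d * d → (a , b) ≡ (c , d)
  sumOfTwoSquares-unique {a} {b} {c} {d} 2∤a 2∣b 2∤c 2∣d p≡a²+b² p≡c²+d² =
    cong₂ _,_ (m*m≡n*n⇒m≡n (+-cancelʳ-≡ (b * b) _ _ a²+b²≡c²+b²)) b≡d
    where
    b≡d : b ≡ d
    b≡d with ≤-total b d
    ... | inj₁ b≤d = b≤d⇒b≡d 2∤a 2∣b 2∤c b≤d p≡a²+b² p≡c²+d²
    ... | inj₂ d≤b = sym (b≤d⇒b≡d 2∤c 2∣d 2∤a d≤b p≡c²+d² p≡a²+b²)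
    a²+b²≡c²+b² : a * a + b * b ≡ c * c + b * b
    a²+b²≡c²+b² = trans (sym p≡a²+b²) (trans p≡c²+d² (cong (λ n → c * c + n * n) (sym b≡d)))

-- Assembling the equivalence.

m^2+n^2≡m*m+n*n : ∀ m n → m ^ 2 + n ^ 2 ≡ m * m + n * n
m^2+n^2≡m*m+n*n m n = cong₂ (λ k l → m * k + n * l) (*-identityʳ m) (*-identityʳ n)

theorem2p1 : (n : ℕ) → Prime n →
    (n % 4 ≡ 1) ⇔
    ∃! {A = ℕ × ℕ} _≡_ (λ (u , v) → (2 ∤ u) × (2 ∣ v) × (n ≡ u ^ 2 + v ^ 2))
theorem2p1 n pr = mk⇔ to from
  where
  to : n % 4 ≡ 1 → ∃! {A = ℕ × ℕ} _≡_ (λ (u , v) → (2 ∤ u) × (2 ∣ v) × (n ≡ u ^ 2 + v ^ 2))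
  to n%4≡1 with u , v , 2∤u , 2∣v , n≡ ← sumOfTwoSquares pr n%4≡1 =
    (u , v) , (2∤u , 2∣v , trans n≡ (sym (m^2+n^2≡m*m+n*n u v))) ,
    λ {(x , y)} (2∤x , 2∣y , n≡′) →
      sumOfTwoSquares-unique pr 2∤u 2∣v 2∤x 2∣y n≡ (trans n≡′ (m^2+n^2≡m*m+n*n x y))

  from : ∃! {A = ℕ × ℕ} _≡_ (λ (u , v) → (2 ∤ u) × (2 ∣ v) × (n ≡ u ^ 2 + v ^ 2)) → n % 4 ≡ 1
  from ((u , v) , (2∤u , 2∣v , n≡) , _) =
    trans (cong (_% 4) (trans n≡ (m^2+n^2≡m*m+n*n u v))) (odd²+even²%4≡1 2∤u 2∣v)
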